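{- Let $A\in\mathcal{V}$ and $\theta\in Con(A)$. Then $\theta$ has $CBLP$ if and only if $\rho(\theta)$ has $CBLP$.
   Context: $\mathcal{V}$ is a congruence modular, semidegenerate variety (no nontrivial algebra has a one-element subalgebra; equivalently $\nabla_B$ is compact for all $B\in\mathcal{V}$) of finite signature. For $B\in\mathcal{V}$: $Con(B)$ is its congruence lattice with bounds $\Delta_B,\nabla_B$, $[\cdot,\cdot]$ the Freese–McKenzie commutator, $K(B)$ the compact congruences. A congruence $\phi\neq\nabla_B$ is prime if $[\alpha,\beta]\subseteq\phi$ implies $\alpha\subseteq\phi$ or $\beta\subseteq\phi$; $\rho(\theta)$ is the intersection of all prime congruences containing $\theta$. $B(Con(B))$ is the Boolean algebra of complemented elements of $Con(B)$. When $K(B)$ is closed under the commutator, the reticulation $L(B)=K(B)/{\equiv}$ ($\alpha\equiv\beta$ iff $\rho(\alpha)=\rho(\beta)$) is a bounded distributive lattice with canonical map $\lambda_B$, which maps $B(Con(B))$ injectively into the Boolean center $B(L(B))$; the reticulation of $B$ preserves the Boolean center if this map $B(Con(B))\to B(L(B))$ is surjective. Standing assumption: for every $B\in\mathcal{V}$, $K(B)$ is closed under the commutator and the reticulation of $B$ preserves the Boolean center. For $\theta\in Con(A)$, congruences of $A/\theta$ are exactly $\chi/\theta$ with $\chi\supseteq\theta$. The congruence $\theta$ has the Congruence Boolean Lifting Property ($CBLP$) if for every $\beta\in B(Con(A/\theta))$ there exists $\alpha\in B(Con(A))$ with $(\alpha\vee\theta)/\theta=\beta$. -}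

module Defs where

open import Level using (Level; _⊔_; Lift; lift) renaming (suc to lsuc)
open import Axiom.ExcludedMiddle using (ExcludedMiddle)
open import Data.Empty using (⊥-elim)
open import Data.Fin using (Fin)
open import Data.List using (List; []; _∷_; _++_; concat; tabulate)
open import Data.List.Membership.Propositional using (_∈_)
open import Data.List.Membership.Propositional.Properties using (∈-++⁺ˡ; ∈-++⁺ʳ; ∈-concat⁺′; ∈-tabulate⁺)
open import Data.List.Relation.Unary.Any using (here)
open import Data.Nat using (ℕ)
open import Data.Product using (Σ; Σ-syntax; ∃-syntax; _×_; _,_; proj₁; proj₂)
open import Data.Sum using (_⊎_; inj₁; inj₂; [_,_])
open import Data.Unit using (⊤; tt)
open import Function using (_∘_; id; case_of_)
open import Relation.Binary.Bundles using (Setoid)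
open import Relation.Binary.Core using (Rel)
open import Relation.Binary.Lattice.Bundles using (Lattice; BoundedLattice)
open import Relation.Binary.PropositionalEquality using (refl)
open import Relation.Binary.Structures using (IsEquivalence)
open import Relation.Nullary using (¬_; yes; no)
open import Relation.Nullary.Decidable using (True; toWitness; fromWitness)
open import Relation.Unary using (Pred)

private variable
  c ℓ ℓ₁ ℓ₂ e : Level

Modular : Lattice c ℓ₁ ℓ₂ → Set (c ⊔ ℓ₁ ⊔ ℓ₂)
Modular L = ∀ x y z → x ≤ z → (x ∨ (y ∧ z)) ≈ ((x ∨ y) ∧ z)
  where open Lattice L

Complemented : (L : BoundedLattice c ℓ₁ ℓ₂) → BoundedLattice.Carrier L → Set (c ⊔ ℓ₁)
Complemented L x = ∃[ y ] ((x ∨ y) ≈ top × (x ∧ y) ≈ bot)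
  where open BoundedLattice L renaming (⊤ to top; ⊥ to bot)

record Signature : Set where
  field
    size  : ℕ
    arity : Fin size → ℕ

open Signature

data Term (S : Signature) (X : Set) : Set where
  var : X → Term S X
  app : (f : Fin (size S)) → (Fin (arity S f) → Term S X) → Term S X

-- Setoid carriers make A / θ an algebra on the carrier of A.  As usual in
-- universal algebra, the universe of an algebra is nonempty.
record Algebra (S : Signature) (ℓ : Level) : Set (lsuc ℓ) where
  field
    setoid : Setoid ℓ ℓ
  open Setoid setoid public using (Carrier; _≈_; isEquivalence)
  field
    op       : (f : Fin (size S)) → (Fin (arity S f) → Carrier) → Carrier
    op-cong  : ∀ f {u v} → (∀ i → u i ≈ v i) → op f u ≈ op f v
    nonempty : Carrier

open Algebra using (Carrier)

module _ {S : Signature} where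

  evaluate : {C : Set ℓ} → ((f : Fin (size S)) → (Fin (arity S f) → C) → C) →
             {X : Set} → Term S X → (X → C) → C
  evaluate op (var x)    η = η x
  evaluate op (app f ts) η = op f (λ i → evaluate op (ts i) η)

  ⟦_⟧ : {X : Set} → Term S X → (A : Algebra S ℓ) → (X → Carrier A) → Carrier A
  ⟦ t ⟧ A = evaluate (Algebra.op A) t

-- A variety is the class of all models of a set of identities.
Identities : Signature → (e : Level) → Set (lsuc e)
Identities S e = Term S ℕ → Term S ℕ → Set e

infix 4 _∈Mod_

_∈Mod_ : ∀ {S} → Algebra S ℓ → Identities S e → Set (ℓ ⊔ e)
A ∈Mod E = ∀ s t → E s t → ∀ η → Algebra._≈_ A (⟦ s ⟧ A η) (⟦ t ⟧ A η)

module _ {S : Signature} {ℓ : Level} (A : Algebra S ℓ) where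
  open Algebra A using (_≈_; op)

  Trivial : Set ℓ
  Trivial = ∀ x y → x ≈ y

  record IsSubuniverse (P : Pred (Carrier A) ℓ) : Set ℓ where
    field
      respects : ∀ {x y} → x ≈ y → P x → P y
      closed   : ∀ f u → (∀ i → P (u i)) → P (op f u)

  HasOneElementSubalgebra : Set (lsuc ℓ)
  HasOneElementSubalgebra =
    Σ[ P ∈ Pred (Carrier A) ℓ ] IsSubuniverse P × (∃[ a ] (P a × (∀ x → P x → x ≈ a)))

record Con {S : Signature} {ℓ : Level} (A : Algebra S ℓ) : Set (lsuc ℓ) where
  open Algebra A using (_≈_; op)
  field
    rel           : Rel (Carrier A) ℓ
    isEquivalence : IsEquivalence rel
    reflexive-≈   : ∀ {x y} → x ≈ y → rel x y
    compatible    : ∀ f {u v} → (∀ i → rel (u i) (v i)) → rel (op f u) (op f v)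
  open IsEquivalence isEquivalence public using (refl; sym; trans)

open Con using (rel)

infixl 8 _/_

_/_ : ∀ {S} (A : Algebra S ℓ) → Con A → Algebra S ℓ
A / θ = record
  { setoid   = record { isEquivalence = Con.isEquivalence θ }
  ; op       = Algebra.op A
  ; op-cong  = Con.compatible θ
  ; nonempty = Algebra.nonempty A
  }

/-∈Mod : ∀ {S} {A : Algebra S ℓ} {E : Identities S e} (θ : Con A) → A ∈Mod E → (A / θ) ∈Mod E
/-∈Mod θ A∈V s t st η = Con.reflexive-≈ θ (A∈V s t st η)

module _ {S : Signature} {ℓ : Level} {A : Algebra S ℓ} where
  open Algebra A using (_≈_; op)

  infix 4 _⊆_ _≐_

  _⊆_ : Con A → Con A → Set ℓ
  α ⊆ β = ∀ {x y} → rel α x y → rel β x y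

  _≐_ : Con A → Con A → Set ℓ
  α ≐ β = α ⊆ β × β ⊆ α

  Δ : Con A
  Δ = record
    { rel           = _≈_
    ; isEquivalence = Algebra.isEquivalence A
    ; reflexive-≈   = id
    ; compatible    = Algebra.op-cong A
    }

  ∇ : Con A
  ∇ = record
    { rel           = λ _ _ → Lift ℓ ⊤
    ; isEquivalence = record { refl = lift tt ; sym = λ _ → lift tt ; trans = λ _ _ → lift tt }
    ; reflexive-≈   = λ _ → lift tt
    ; compatible    = λ _ _ → lift tt
    }

  data Generated (R : Rel (Carrier A) ℓ) : Rel (Carrier A) ℓ where
    base   : ∀ {x y} → R x y → Generated R x y
    equal  : ∀ {x y} → x ≈ y → Generated R x y
    symm   : ∀ {x y} → Generated R x y → Generated R y x
    transi : ∀ {x y z} → Generated R x y → Generated R y z → Generated R x z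
    compat : ∀ f {u v} → (∀ i → Generated R (u i) (v i)) → Generated R (op f u) (op f v)

  Cg : Rel (Carrier A) ℓ → Con A
  Cg R = record
    { rel           = Generated R
    ; isEquivalence = record
      { refl = equal (IsEquivalence.refl (Algebra.isEquivalence A)) ; sym = symm ; trans = transi }
    ; reflexive-≈   = equal
    ; compatible    = compat
    }

  Cg-least : ∀ {R} (θ : Con A) → (∀ {x y} → R x y → rel θ x y) → Cg R ⊆ θ
  Cg-least θ R⊆θ (base r)      = R⊆θ r
  Cg-least θ R⊆θ (equal p)     = Con.reflexive-≈ θ p
  Cg-least θ R⊆θ (symm p)      = Con.sym θ (Cg-least θ R⊆θ p)
  Cg-least θ R⊆θ (transi p q)  = Con.trans θ (Cg-least θ R⊆θ p) (Cg-least θ R⊆θ q)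
  Cg-least θ R⊆θ (compat f ps) = Con.compatible θ f (λ i → Cg-least θ R⊆θ (ps i))

  infixr 6 _∨_
  infixr 7 _∩_

  _∨_ : Con A → Con A → Con A
  α ∨ β = Cg (λ x y → rel α x y ⊎ rel β x y)

  _∩_ : Con A → Con A → Con A
  α ∩ β = record
    { rel           = λ x y → rel α x y × rel β x y
    ; isEquivalence = record
      { refl  = Con.refl α , Con.refl β
      ; sym   = λ (p , q) → Con.sym α p , Con.sym β q
      ; trans = λ (p , q) (p′ , q′) → Con.trans α p p′ , Con.trans β q q′
      }
    ; reflexive-≈   = λ p → Con.reflexive-≈ α p , Con.reflexive-≈ β p
    ; compatible    = λ f ps → Con.compatible α f (proj₁ ∘ ps) , Con.compatible β f (proj₂ ∘ ps)
    }

  ⋁ : {I : Set ℓ} → (I → Con A) → Con A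
  ⋁ γ = Cg (λ x y → ∃[ i ] rel (γ i) x y)

  ∨-least : ∀ {α β} (γ : Con A) → α ⊆ γ → β ⊆ γ → α ∨ β ⊆ γ
  ∨-least γ p q = Cg-least γ [ p , q ]

  -- For χ ⊇ θ, the congruence χ / θ of A / θ.
  quotient : (χ θ : Con A) → θ ⊆ χ → Con (A / θ)
  quotient χ θ θ⊆χ = record
    { rel           = rel χ
    ; isEquivalence = Con.isEquivalence χ
    ; reflexive-≈   = θ⊆χ
    ; compatible    = Con.compatible χ
    }

ConLattice : ∀ {S} → Algebra S ℓ → BoundedLattice (lsuc ℓ) ℓ ℓ
ConLattice A = record
  { Carrier = Con A
  ; _≈_ = _≐_
  ; _≤_ = _⊆_
  ; _∨_ = _∨_
  ; _∧_ = _∩_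
  ; ⊤ = ∇
  ; ⊥ = Δ
  ; isBoundedLattice = record
    { isLattice = record
      { isPartialOrder = record
        { isPreorder = record
          { isEquivalence = record
            { refl  = (λ p → p) , (λ p → p)
            ; sym   = λ (p , q) → (λ r → q r) , (λ r → p r)
            ; trans = λ (p , q) (p′ , q′) → (λ r → p′ (p r)) , (λ r → q (q′ r))
            }
          ; reflexive = λ (p , _) r → p r
          ; trans     = λ p q r → q (p r)
          }
        ; antisym = λ p q → (λ r → p r) , (λ r → q r)
        }
      ; supremum = λ α β → (λ p → base (inj₁ p)) , (λ p → base (inj₂ p)) , λ γ p q → ∨-least {α = α} {β} γ p q
      ; infimum  = λ α β → proj₁ , proj₂ , λ γ p q r → p r , q r
      }
    ; maximum = λ _ _ → lift tt
    ; minimum = λ θ → Con.reflexive-≈ θ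
    }
  }

module _ {S : Signature} {ℓ : Level} {A : Algebra S ℓ} where
  restrict : {I : Set ℓ} → (I → Con A) → (js : List I) → Σ[ i ∈ I ] (i ∈ js) → Con A
  restrict γ js (i , _) = γ i

  -- Compactness in the complete lattice Con A.
  IsCompact : Con A → Set (lsuc ℓ)
  IsCompact α = ∀ {I : Set ℓ} (γ : I → Con A) → α ⊆ ⋁ γ → Σ[ js ∈ List I ] α ⊆ ⋁ (restrict γ js)

  ⋁-restrict-mono : ∀ {I : Set ℓ} (γ : I → Con A) {js ks : List I} →
                    (∀ {i} → i ∈ js → i ∈ ks) → ⋁ (restrict γ js) ⊆ ⋁ (restrict γ ks)
  ⋁-restrict-mono γ {ks = ks} js⊆ks =
    Cg-least (⋁ (restrict γ ks)) (λ ((i , i∈js) , p) → base ((i , js⊆ks i∈js) , p))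

  ⋁-restrict-concat : ∀ {I : Set ℓ} (γ : I → Con A) {n} (js : Fin n → List I) (k : Fin n) →
                      ⋁ (restrict γ (js k)) ⊆ ⋁ (restrict γ (concat (tabulate js)))
  ⋁-restrict-concat γ js k =
    ⋁-restrict-mono γ (λ i∈ → ∈-concat⁺′ i∈ (∈-tabulate⁺ {f = js} k))

  ⋁-finitary : ∀ {I : Set ℓ} (γ : I → Con A) {x y} → rel (⋁ γ) x y →
               Σ[ js ∈ List I ] rel (⋁ (restrict γ js)) x y
  ⋁-finitary γ (base (i , p)) = i ∷ [] , base ((i , here refl) , p)
  ⋁-finitary γ (equal p)      = [] , equal p
  ⋁-finitary γ (symm p)       = let js , q = ⋁-finitary γ p in js , symm q
  ⋁-finitary γ (transi p q)   =
    let js , p′ = ⋁-finitary γ p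
        ks , q′ = ⋁-finitary γ q
    in js ++ ks , transi (⋁-restrict-mono γ ∈-++⁺ˡ p′) (⋁-restrict-mono γ (∈-++⁺ʳ js) q′)
  ⋁-finitary γ (compat f ps)  =
    let js = λ i → proj₁ (⋁-finitary γ (ps i))
    in concat (tabulate js)
     , compat f (λ i → ⋁-restrict-concat γ js i (proj₂ (⋁-finitary γ (ps i))))

  Δ-compact : IsCompact Δ
  Δ-compact γ _ = [] , equal

  ∨-compact : ∀ {α β} → IsCompact α → IsCompact β → IsCompact (α ∨ β)
  ∨-compact {α} {β} cα cβ γ p =
    let js , q = cα γ (λ r → p (base (inj₁ r)))
        ks , s = cβ γ (λ r → p (base (inj₂ r)))
    in js ++ ks , ∨-least {α = α} {β} (⋁ (restrict γ (js ++ ks)))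
         (λ r → ⋁-restrict-mono γ ∈-++⁺ˡ (q r))
         (λ r → ⋁-restrict-mono γ (∈-++⁺ʳ js) (s r))

module _ {S : Signature} {ℓ : Level} {A : Algebra S ℓ} where
  open Algebra A using (_≈_; op)

  -- α centralizes β modulo δ: for every matrix
  --   t(a , b)   t(a , b′)
  --   t(a′, b)   t(a′, b′)
  -- with a α a′ and b β b′, if its first row is in δ then so is its second.
  Centralizes : Con A → Con A → Con A → Set ℓ
  Centralizes α β δ =
    ∀ {m n} (t : Term S (Fin m ⊎ Fin n)) (a a′ : Fin m → Carrier A) (b b′ : Fin n → Carrier A) →
    (∀ i → rel α (a i) (a′ i)) → (∀ j → rel β (b j) (b′ j)) →
    rel δ (⟦ t ⟧ A [ a , b ]) (⟦ t ⟧ A [ a , b′ ]) →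
    rel δ (⟦ t ⟧ A [ a′ , b ]) (⟦ t ⟧ A [ a′ , b′ ])

  data Commutator (α β : Con A) : Rel (Carrier A) ℓ where
    equal  : ∀ {x y} → x ≈ y → Commutator α β x y
    symm   : ∀ {x y} → Commutator α β x y → Commutator α β y x
    transi : ∀ {x y z} → Commutator α β x y → Commutator α β y z → Commutator α β x z
    compat : ∀ f {u v} → (∀ i → Commutator α β (u i) (v i)) → Commutator α β (op f u) (op f v)
    term   : ∀ {m n} (t : Term S (Fin m ⊎ Fin n)) (a a′ : Fin m → Carrier A) (b b′ : Fin n → Carrier A) →
             (∀ i → rel α (a i) (a′ i)) → (∀ j → rel β (b j) (b′ j)) →
             Commutator α β (⟦ t ⟧ A [ a , b ]) (⟦ t ⟧ A [ a , b′ ]) →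
             Commutator α β (⟦ t ⟧ A [ a′ , b ]) (⟦ t ⟧ A [ a′ , b′ ])

  -- The least congruence δ such that α centralizes β modulo δ; see
  -- [,]-centralizes and [,]-least.
  [_,_]ᶜ : Con A → Con A → Con A
  [ α , β ]ᶜ = record
    { rel           = Commutator α β
    ; isEquivalence = record
      { refl = equal (IsEquivalence.refl (Algebra.isEquivalence A)) ; sym = symm ; trans = transi }
    ; reflexive-≈   = equal
    ; compatible    = compat
    }

  [,]-centralizes : ∀ α β → Centralizes α β [ α , β ]ᶜ
  [,]-centralizes α β = term

  [,]-least : ∀ α β δ → Centralizes α β δ → [ α , β ]ᶜ ⊆ δ
  [,]-least α β δ C (equal p)     = Con.reflexive-≈ δ p
  [,]-least α β δ C (symm p)      = Con.sym δ ([,]-least α β δ C p)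
  [,]-least α β δ C (transi p q)  = Con.trans δ ([,]-least α β δ C p) ([,]-least α β δ C q)
  [,]-least α β δ C (compat f ps) = Con.compatible δ f (λ i → [,]-least α β δ C (ps i))
  [,]-least α β δ C (term t a a′ b b′ p q r) = C t a a′ b b′ p q ([,]-least α β δ C r)

  ⟦⟧-compatible : ∀ (θ : Con A) {X : Set} (t : Term S X) {η η′ : X → Carrier A} →
                  (∀ x → rel θ (η x) (η′ x)) → rel θ (⟦ t ⟧ A η) (⟦ t ⟧ A η′)
  ⟦⟧-compatible θ (var x)    p = p x
  ⟦⟧-compatible θ (app f ts) p = Con.compatible θ f (λ i → ⟦⟧-compatible θ (ts i) p)

  [,]⊆ˡ : ∀ α β → [ α , β ]ᶜ ⊆ α
  [,]⊆ˡ α β = [,]-least α β α λ t a a′ b b′ p q r →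
    Con.trans α (Con.sym α (⟦⟧-compatible α t [ p , (λ _ → Con.refl α) ]))
      (Con.trans α r (⟦⟧-compatible α t [ p , (λ _ → Con.refl α) ]))

  [,]⊆ʳ : ∀ α β → [ α , β ]ᶜ ⊆ β
  [,]⊆ʳ α β = [,]-least α β β λ t a a′ b b′ p q r →
    ⟦⟧-compatible β t [ (λ _ → Con.refl β) , q ]

  record IsPrime (φ : Con A) : Set (lsuc ℓ) where
    field
      proper : ¬ (φ ≐ ∇)
      prime  : ∀ α β → [ α , β ]ᶜ ⊆ φ → α ⊆ φ ⊎ β ⊆ φ

  -- The intersection of all prime congruences containing θ quantifies over
  -- Con A, hence is a relation in Set (lsuc ℓ).  Excluded middle serves to
  -- replace it by an equivalent one in Set ℓ; see ρ-elim and ρ-intro.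
  ρ : ExcludedMiddle (lsuc ℓ) → Con A → Con A
  ρ em θ = record
    { rel           = λ x y → Lift ℓ (True (em {R x y}))
    ; isEquivalence = record
      { refl  = into λ φ _ _ → Con.refl φ
      ; sym   = λ p → into λ φ P i → Con.sym φ (out p φ P i)
      ; trans = λ p q → into λ φ P i → Con.trans φ (out p φ P i) (out q φ P i)
      }
    ; reflexive-≈   = λ p → into λ φ _ _ → Con.reflexive-≈ φ p
    ; compatible    = λ f ps → into λ φ P i → Con.compatible φ f (λ k → out (ps k) φ P i)
    }
    where
    R : Carrier A → Carrier A → Set (lsuc ℓ)
    R x y = ∀ φ → IsPrime φ → θ ⊆ φ → rel φ x y

    into : ∀ {x y} → R x y → Lift ℓ (True (em {R x y}))
    into r = lift (fromWitness r)

    out : ∀ {x y} → Lift ℓ (True (em {R x y})) → R x y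
    out (lift p) = toWitness p

  module _ (em : ExcludedMiddle (lsuc ℓ)) where

    ρ-elim : ∀ θ {x y} → rel (ρ em θ) x y → ∀ φ → IsPrime φ → θ ⊆ φ → rel φ x y
    ρ-elim θ (lift p) = toWitness p

    ρ-intro : ∀ θ {x y} → (∀ φ → IsPrime φ → θ ⊆ φ → rel φ x y) → rel (ρ em θ) x y
    ρ-intro θ r = lift (fromWitness r)

    ρ-mono : ∀ α β → α ⊆ β → ρ em α ⊆ ρ em β
    ρ-mono α β α⊆β p = ρ-intro β λ φ P i → ρ-elim α p φ P (λ q → i (α⊆β q))

CompactClosedUnderCommutator : ∀ {S} → Algebra S ℓ → Set (lsuc ℓ)
CompactClosedUnderCommutator A =
  ∀ (α β : Con A) → IsCompact α → IsCompact β → IsCompact [ α , β ]ᶜ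

module _ {S : Signature} {ℓ : Level} (em : ExcludedMiddle (lsuc ℓ)) (A : Algebra S ℓ)
         (∇-compact : IsCompact (∇ {A = A})) (closed : CompactClosedUnderCommutator A) where

  -- L(A) = K(A)/≡ as a setoid lattice, so that the canonical map λ_A is the
  -- identity on K(A): λ(α) ∨ λ(β) = λ(α ∨ β), λ(α) ∧ λ(β) = λ([α , β]),
  -- and λ(α) ≤ λ(β) iff ρ(α) ⊆ ρ(β).
  reticulation : BoundedLattice (lsuc ℓ) ℓ ℓ
  reticulation = record
    { Carrier = Σ[ α ∈ Con A ] IsCompact α
    ; _≈_ = λ (α , _) (β , _) → ρ em α ≐ ρ em β
    ; _≤_ = λ (α , _) (β , _) → ρ em α ⊆ ρ em β
    ; _∨_ = λ (α , cα) (β , cβ) → α ∨ β , ∨-compact {α = α} {β} cα cβ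
    ; _∧_ = λ (α , cα) (β , cβ) → [ α , β ]ᶜ , closed α β cα cβ
    ; ⊤ = ∇ , ∇-compact
    ; ⊥ = Δ , Δ-compact
    ; isBoundedLattice = record
      { isLattice = record
        { isPartialOrder = record
          { isPreorder = record
            { isEquivalence = record
              { refl  = (λ p → p) , (λ p → p)
              ; sym   = λ (p , q) → (λ r → q r) , (λ r → p r)
              ; trans = λ (p , q) (p′ , q′) → (λ r → p′ (p r)) , (λ r → q (q′ r))
              }
            ; reflexive = λ (p , _) r → p r
            ; trans     = λ p q r → q (p r)
            }
          ; antisym = λ p q → (λ r → p r) , (λ r → q r)
          }
        ; supremum = λ (α , _) (β , _) →
            ρ-mono em α (α ∨ β) (λ p → base (inj₁ p)) ,
            ρ-mono em β (α ∨ β) (λ p → base (inj₂ p)) ,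
            λ (γ , _) p q r → ρ-intro em γ λ φ P i →
              ρ-elim em (α ∨ β) r φ P (∨-least {α = α} {β} φ
                (λ s → ρ-elim em γ (p (ρ-intro em α λ ψ _ j → j s)) φ P i)
                (λ s → ρ-elim em γ (q (ρ-intro em β λ ψ _ j → j s)) φ P i))
        ; infimum = λ (α , _) (β , _) →
            ρ-mono em [ α , β ]ᶜ α ([,]⊆ˡ α β) ,
            ρ-mono em [ α , β ]ᶜ β ([,]⊆ʳ α β) ,
            λ (γ , _) p q r → ρ-intro em [ α , β ]ᶜ λ φ P i →
              case IsPrime.prime P α β i of λ where
                (inj₁ α⊆φ) → ρ-elim em α (p r) φ P α⊆φ
                (inj₂ β⊆φ) → ρ-elim em β (q r) φ P β⊆φ
        }
      ; maximum = λ (α , _) → ρ-mono em α ∇ (λ _ → lift tt)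
      ; minimum = λ (α , _) → ρ-mono em Δ α (Con.reflexive-≈ α)
      }
    }

  -- Every element of B(L(A)) is λ_A(α) for some α in B(Con A); such α are
  -- automatically compact when ∇ is and Con A is modular.
  PreservesBooleanCenter : Set (lsuc ℓ)
  PreservesBooleanCenter =
    ∀ x → Complemented reticulation x →
    Σ[ α ∈ BoundedLattice.Carrier reticulation ]
      Complemented (ConLattice A) (proj₁ α) × BoundedLattice._≈_ reticulation α x

module _ {S : Signature} {e : Level} (ℓ : Level) (E : Identities S e) where

  CongruenceModular : Set (lsuc ℓ ⊔ e)
  CongruenceModular =
    ∀ (B : Algebra S ℓ) → B ∈Mod E → Modular (BoundedLattice.lattice (ConLattice B))

  Semidegenerate : Set (lsuc ℓ ⊔ e)
  Semidegenerate =
    ∀ (B : Algebra S ℓ) → B ∈Mod E → ¬ Trivial B → ¬ HasOneElementSubalgebra B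

-- With a in B and θ generated by the finitely many pairs (f(a,…,a) , a), the
-- class of a is a one-element subalgebra of B / θ, whence θ = ∇.
semidegenerate⇒∇-compact : ∀ {S} {E : Identities S e} → ExcludedMiddle (lsuc ℓ) → Semidegenerate ℓ E →
                           (B : Algebra S ℓ) → B ∈Mod E → IsCompact (∇ {A = B})
semidegenerate⇒∇-compact {ℓ = ℓ} {S = S} {E} em sd B B∈V {I} γ ∇⊆⋁γ = js , λ {x} {y} _ → θ⊆ (trivial x y)
  where
  open Algebra B using (_≈_; op) renaming (nonempty to a)

  data R : Rel (Carrier B) ℓ where
    pair : ∀ f → R (op f (λ _ → a)) a

  θ : Con B
  θ = Cg R

  one : HasOneElementSubalgebra (B / θ)
  one = (λ x → rel θ x a)
      , record { respects = λ p q → Con.trans θ (Con.sym θ p) q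
               ; closed   = λ f u ps → Con.trans θ (Con.compatible θ f ps) (base (pair f)) }
      , a , Con.refl θ , λ _ p → p

  trivial : Trivial (B / θ)
  trivial with em {Lift (lsuc ℓ) (Trivial (B / θ))}
  ... | yes (lift p) = p
  ... | no ¬p = ⊥-elim (sd (B / θ) (/-∈Mod {E = E} θ B∈V) (λ p → ¬p (lift p)) one)

  support : ∀ f → Σ[ ks ∈ List I ] rel (⋁ (restrict γ ks)) (op f (λ _ → a)) a
  support f = ⋁-finitary γ (∇⊆⋁γ (lift tt))

  js : List I
  js = concat (tabulate (λ f → proj₁ (support f)))

  θ⊆ : θ ⊆ ⋁ (restrict γ js)
  θ⊆ = Cg-least (⋁ (restrict γ js))
    λ { (pair f) → ⋁-restrict-concat γ (λ f → proj₁ (support f)) f (proj₂ (support f)) }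

CBLP : ∀ {S} {A : Algebra S ℓ} → Con A → Set (lsuc ℓ)
CBLP {A = A} θ =
  ∀ (β : Con (A / θ)) → Complemented (ConLattice (A / θ)) β →
  Σ[ α ∈ Con A ] Complemented (ConLattice A) α
    × quotient (α ∨ θ) θ (λ p → base (inj₂ p)) ≐ β

{-# OPTIONS --safe #-}
module Submission where

-- The key is an absorption law: if [α , β] ⊆ η and α ∨ η = ∇ then β ⊆ η.
-- View β as a subalgebra of A² and take its largest congruence Θ for which the
-- set of pairs in η is a union of classes.  The shifting lemma in Con β turns
-- [α , β] ⊆ η into centrality of β modulo η, so Θ collapses the diagonal to a
-- point; by semidegeneracy Θ is then ∇, that is, β ⊆ η.
--
-- Absorption makes maximal congruences prime, so a congruence contained in no
-- prime is ∇, and it forces a complemented congruence over θ to be determined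
-- by its join with ρ θ.  Conversely a complemented congruence over ρ θ
-- contains a compact one that is complemented in the reticulation of A / θ, so
-- it comes from B(Con(A / θ)).  Hence B(Con(A / θ)) and B(Con(A / ρ θ))
-- correspond via χ ↦ χ ∨ ρ θ.

open import Defs
open import Level using (Level; Lift; lift; lower) renaming (suc to lsuc)
open import Axiom.ExcludedMiddle using (ExcludedMiddle)
open import Axiom.Extensionality.Propositional using (Extensionality; lower-extensionality)
open import Data.Bool using (Bool; T)
open import Data.Empty using (⊥; ⊥-elim)
open import Data.Fin using (Fin; zero; suc; _↑ˡ_; _↑ʳ_; splitAt)
open import Data.Fin.Properties using (_≟_; splitAt-↑ˡ; splitAt-↑ʳ)
open import Data.List using (List; []; _∷_)
open import Data.List.Membership.Propositional using (_∈_)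
open import Data.List.Relation.Unary.Any using (here; there)
open import Data.Nat as ℕ using (_+_)
open import Data.Product using (Σ-syntax; ∃-syntax; _×_; _,_; proj₁; proj₂; swap)
open import Data.Sum using (_⊎_; inj₁; inj₂; [_,_])
open import Data.Unit using (tt)
open import Data.Vec.Functional using () renaming (_∷_ to _◂_)
open import Function using (_∘_; id; const; case_of_)
open import Function.Bundles using (_⇔_; mk⇔)
open import Relation.Binary.Core using (Rel)
open import Relation.Binary.Lattice.Bundles using (BoundedLattice)
open import Relation.Binary.PropositionalEquality using (_≡_; _≢_; refl; cong; subst)
open import Relation.Binary.Structures using (IsEquivalence)
open import Relation.Nullary using (¬_; Dec; does; yes; no)
open import Relation.Nullary.Decidable using (True; toWitness; fromWitness; map′; does-⇔)
open import Relation.Unary using (Pred)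

open Signature
open Algebra using (Carrier)
open Con using (rel)

private variable
  a r g ℓ e : Level
  S : Signature

-- Syntactic congruences.

-- Coordinates change one at a time, the first one first and then held at its new value. `ext`
-- stands in for function extensionality: the rebuilt tuples agree with the given ones only
-- pointwise.
coordinatewise : ∀ {n} {X : Set a} (R : Rel X r) (G : (Fin n → X) → Set g) →
  (∀ {u v} → (∀ i → u i ≡ v i) → G u → G v) →
  (∀ i {u v} → (∀ j → j ≢ i → u j ≡ v j) → R (u i) (v i) → G u → G v) →
  ∀ {u v} → (∀ i → R (u i) (v i)) → G u → G v
coordinatewise {n = ℕ.zero}  R G ext step rs = ext λ ()
coordinatewise {n = ℕ.suc n} R G ext step {u} {v} rs Gu =
  ext (λ { zero → refl ; (suc _) → refl })
    (coordinatewise R (λ w → G (v zero ◂ w))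
      (λ eq → ext λ { zero → refl ; (suc i) → eq i })
      (λ i off → step (suc i) λ { zero _ → refl ; (suc j) ne → off j (ne ∘ cong suc) })
      (λ i → rs (suc i))
      (step zero (λ { zero ne → ⊥-elim (ne refl) ; (suc _) _ → refl }) (rs zero) Gu))

bind : {X Y : Set} → Term S X → (X → Term S Y) → Term S Y
bind (var x)    σ = σ x
bind (app f ts) σ = app f (λ i → bind (ts i) σ)

module _ (A : Algebra S ℓ) where
  open Algebra A using (_≈_; op; op-cong)
  private module ≈ = IsEquivalence (Algebra.isEquivalence A)

  ⟦bind⟧ : {X Y : Set} (t : Term S X) (σ : X → Term S Y) (η : Y → Carrier A) →
           ⟦ bind t σ ⟧ A η ≈ ⟦ t ⟧ A (λ x → ⟦ σ x ⟧ A η)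
  ⟦bind⟧ (var x)    σ η = ≈.refl
  ⟦bind⟧ (app f ts) σ η = op-cong f (λ i → ⟦bind⟧ (ts i) σ η)

  ⟦⟧-cong : {X : Set} (t : Term S X) {η η′ : X → Carrier A} →
            (∀ x → η x ≈ η′ x) → ⟦ t ⟧ A η ≈ ⟦ t ⟧ A η′
  ⟦⟧-cong = ⟦⟧-compatible {A = A} Δ

  module _ (D : Pred (Carrier A) ℓ) (D-resp : ∀ {x y} → x ≈ y → D x → D y) where

    -- A term `t` with one distinguished variable and parameters `c` is a unary polynomial; this is
    -- one half of the syntactic congruence of `D`.
    Implies : Rel (Carrier A) ℓ
    Implies x y = ∀ {n} (t : Term S (Fin 1 ⊎ Fin n)) (c : Fin n → Carrier A) →
      D (⟦ t ⟧ A [ const x , c ]) → D (⟦ t ⟧ A [ const y , c ])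

    -- With all arguments of `f` but one fixed, a polynomial at `op f w` is a polynomial in the
    -- remaining argument; the fixed arguments become parameters.
    Implies-compatible : ∀ f {u v} → (∀ i → Implies (u i) (v i)) → Implies (op f u) (op f v)
    Implies-compatible f {u} {v} ps {n} t c =
      coordinatewise Implies (λ w → D (⟦ t ⟧ A [ const (op f w) , c ]))
        (λ eq → D-resp (⟦⟧-cong t [ (λ _ → op-cong f (λ i → ≈.reflexive (eq i))) , (λ _ → ≈.refl) ]))
        -- `u` and `v` differ only at `i`, where `plug i` has the distinguished variable, so the
        -- parameters taken from `u` serve both.
        (λ i {u} {v} off p d →
          D-resp (plug-eval i u v off) (p (plug i) (params u)
            (D-resp (≈.sym (plug-eval i u u (λ _ _ → refl))) d)))
        ps
      where
      params : (Fin (arity S f) → Carrier A) → Fin (arity S f + n) → Carrier A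
      params w = [ w , c ] ∘ splitAt (arity S f)

      argument : (i j : Fin (arity S f)) → Dec (j ≡ i) → Term S (Fin 1 ⊎ Fin (arity S f + n))
      argument i j (yes _) = var (inj₁ zero)
      argument i j (no _)  = var (inj₂ (j ↑ˡ n))

      plug : Fin (arity S f) → Term S (Fin 1 ⊎ Fin (arity S f + n))
      plug i = bind t [ (λ _ → app f (λ j → argument i j (j ≟ i))) , (λ k → var (inj₂ (arity S f ↑ʳ k))) ]

      argument-eval : ∀ i w w′ → (∀ j → j ≢ i → w j ≡ w′ j) → ∀ j (d : Dec (j ≡ i)) →
                      ⟦ argument i j d ⟧ A [ const (w′ i) , params w ] ≈ w′ j
      argument-eval i w w′ off j (yes refl) = ≈.refl
      argument-eval i w w′ off j (no ne)    =
        ≈.trans (≈.reflexive (cong [ w , c ] (splitAt-↑ˡ _ j n))) (≈.reflexive (off j ne))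

      plug-eval : ∀ i w w′ → (∀ j → j ≢ i → w j ≡ w′ j) →
        ⟦ plug i ⟧ A [ const (w′ i) , params w ] ≈ ⟦ t ⟧ A [ const (op f w′) , c ]
      plug-eval i w w′ off = ≈.trans (⟦bind⟧ t _ _) (⟦⟧-cong t
        [ (λ _ → op-cong f (λ j → argument-eval i w w′ off j (j ≟ i)))
        , (λ k → ≈.reflexive (cong [ w , c ] (splitAt-↑ʳ (arity S f) n k))) ])

    -- The largest congruence of which D is a union of classes.
    syntactic : Con A
    syntactic = record
      { rel           = λ x y → Implies x y × Implies y x
      ; isEquivalence = record
        { refl  = (λ t c d → d) , (λ t c d → d)
        ; sym   = λ (p , q) → (λ {n} → q {n}) , (λ {n} → p {n})
        ; trans = λ (p , q) (p′ , q′) →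
            (λ t c d → p′ t c (p t c d)) , (λ t c d → q t c (q′ t c d))
        }
      ; reflexive-≈   = λ p →
          (λ t c → D-resp (⟦⟧-cong t [ (λ _ → p) , (λ _ → ≈.refl) ])) ,
          (λ t c → D-resp (⟦⟧-cong t [ (λ _ → ≈.sym p) , (λ _ → ≈.refl) ]))
      ; compatible    = λ f ps →
          (λ {n} → Implies-compatible f (λ i {m} → proj₁ (ps i) {m}) {n}) ,
          (λ {n} → Implies-compatible f (λ i {m} → proj₂ (ps i) {m}) {n})
      }

    syntactic-saturates : ∀ {x y} → rel syntactic x y → D x → D y
    syntactic-saturates (p , _) = p {0} (var (inj₁ zero)) (λ ())

-- A congruence as a subalgebra of the square; annihilators.

module _ {A : Algebra S ℓ} where
  open Algebra A using (_≈_; op; op-cong)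
  private module ≈ = IsEquivalence (Algebra.isEquivalence A)

  -- β as a subalgebra of A².
  pairs : Con A → Algebra S ℓ
  pairs β = record
    { setoid   = record
      { Carrier = ∃[ x ] ∃[ y ] rel β x y
      ; _≈_ = λ (x , y , _) (x′ , y′ , _) → x ≈ x′ × y ≈ y′
      ; isEquivalence = record
        { refl  = ≈.refl , ≈.refl
        ; sym   = λ (p , q) → ≈.sym p , ≈.sym q
        ; trans = λ (p , q) (p′ , q′) → ≈.trans p p′ , ≈.trans q q′
        }
      }
    ; op       = λ f u → op f (proj₁ ∘ u) , op f (proj₁ ∘ proj₂ ∘ u) , Con.compatible β f (proj₂ ∘ proj₂ ∘ u)
    ; op-cong  = λ f ps → op-cong f (proj₁ ∘ ps) , op-cong f (proj₂ ∘ ps)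
    ; nonempty = Algebra.nonempty A , Algebra.nonempty A , Con.refl β
    }

  module _ (β : Con A) where
    private P = pairs β

    fst snd : Carrier P → Carrier A
    fst = proj₁
    snd = proj₁ ∘ proj₂

    diagonal : Carrier A → Carrier P
    diagonal x = x , x , Con.refl β

    fst-⟦⟧ : {X : Set} (t : Term S X) {η : X → Carrier P} {ζ : X → Carrier A} →
             (∀ x → fst (η x) ≈ ζ x) → fst (⟦ t ⟧ P η) ≈ ⟦ t ⟧ A ζ
    fst-⟦⟧ (var x)    p = p x
    fst-⟦⟧ (app f ts) p = op-cong f (λ i → fst-⟦⟧ (ts i) p)

    snd-⟦⟧ : {X : Set} (t : Term S X) {η : X → Carrier P} {ζ : X → Carrier A} →
             (∀ x → snd (η x) ≈ ζ x) → snd (⟦ t ⟧ P η) ≈ ⟦ t ⟧ A ζ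
    snd-⟦⟧ (var x)    p = p x
    snd-⟦⟧ (app f ts) p = op-cong f (λ i → snd-⟦⟧ (ts i) p)

    pairs-∈Mod : {E : Identities S e} → A ∈Mod E → P ∈Mod E
    pairs-∈Mod A∈V s t st η =
      ≈.trans (fst-⟦⟧ s λ _ → ≈.refl) (≈.trans (A∈V s t st (fst ∘ η)) (≈.sym (fst-⟦⟧ t λ _ → ≈.refl))) ,
      ≈.trans (snd-⟦⟧ s λ _ → ≈.refl) (≈.trans (A∈V s t st (snd ∘ η)) (≈.sym (snd-⟦⟧ t λ _ → ≈.refl)))

    lift₁ lift₂ : Con A → Con P
    lift₁ δ = record
      { rel           = λ p q → rel δ (fst p) (fst q)
      ; isEquivalence = record { refl = Con.refl δ ; sym = Con.sym δ ; trans = Con.trans δ }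
      ; reflexive-≈   = λ (p , _) → Con.reflexive-≈ δ p
      ; compatible    = λ f → Con.compatible δ f
      }
    lift₂ δ = record
      { rel           = λ p q → rel δ (snd p) (snd q)
      ; isEquivalence = record { refl = Con.refl δ ; sym = Con.sym δ ; trans = Con.trans δ }
      ; reflexive-≈   = λ (_ , p) → Con.reflexive-≈ δ p
      ; compatible    = λ f → Con.compatible δ f
      }

    module _ (δ : Con A) where

      ≈-resp : ∀ {x x′ y y′} → x ≈ x′ → y ≈ y′ → rel δ x y → rel δ x′ y′
      ≈-resp p q d = Con.trans δ (Con.sym δ (Con.reflexive-≈ δ p)) (Con.trans δ d (Con.reflexive-≈ δ q))

      saturating : Con P
      saturating = syntactic P (λ p → rel δ (fst p) (snd p)) (λ (p , q) → ≈-resp p q)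

      saturating-saturates : ∀ {p q} → rel saturating p q → rel δ (fst p) (snd p) → rel δ (fst q) (snd q)
      saturating-saturates {p} {q} =
        syntactic-saturates P (λ p → rel δ (fst p) (snd p)) (λ (p , q) → ≈-resp p q) {p} {q}

      -- The largest congruence centralizing β modulo δ.
      annihilator : Con A
      annihilator = record
        { rel           = λ x y → rel saturating (diagonal x) (diagonal y)
        ; isEquivalence = record
          { refl  = λ {x} → Con.refl saturating {diagonal x}
          ; sym   = λ {x} {y} → Con.sym saturating {diagonal x} {diagonal y}
          ; trans = λ {x} {y} {z} → Con.trans saturating {diagonal x} {diagonal y} {diagonal z}
          }
        ; reflexive-≈   = λ {x} {y} p → Con.reflexive-≈ saturating {diagonal x} {diagonal y} (p , p)
        ; compatible    = λ f {u} {v} ps →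
            Con.trans saturating {_} {Algebra.op P f (diagonal ∘ u)} {_}
              (Con.reflexive-≈ saturating (≈.refl , ≈.refl))
            (Con.trans saturating {_} {Algebra.op P f (diagonal ∘ v)} {_}
              (Con.compatible saturating f {diagonal ∘ u} {diagonal ∘ v} ps)
              (Con.reflexive-≈ saturating (≈.refl , ≈.refl)))
        }

      -- A unary polynomial of `P` at `diagonal x` is one row of a matrix whose columns come from
      -- the two coordinates of `c`; centrality passes from the row of `x` to the row of `y`.
      ⊆annihilator : (α : Con A) → Centralizes α β δ → α ⊆ annihilator
      ⊆annihilator α C xαy =
        (λ t c → one t c xαy) , (λ t c → one t c (Con.sym α xαy))
        where
        one : ∀ {x y n} (t : Term S (Fin 1 ⊎ Fin n)) (c : Fin n → Carrier P) → rel α x y →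
              rel δ (fst (⟦ t ⟧ P [ const (diagonal x) , c ])) (snd (⟦ t ⟧ P [ const (diagonal x) , c ])) →
              rel δ (fst (⟦ t ⟧ P [ const (diagonal y) , c ])) (snd (⟦ t ⟧ P [ const (diagonal y) , c ]))
        one t c xαy d = ≈-resp (≈.sym (fst-⟦⟧ t refl₁)) (≈.sym (snd-⟦⟧ t refl₂))
          (C t _ _ (fst ∘ c) (snd ∘ c) (λ _ → xαy) (proj₂ ∘ proj₂ ∘ c)
            (≈-resp (fst-⟦⟧ t refl₁) (snd-⟦⟧ t refl₂) d))
          where
          refl₁ : ∀ {x} k → fst ([ const (diagonal x) , c ] k) ≈ [ const x , fst ∘ c ] k
          refl₁ = [ (λ _ → ≈.refl) , (λ _ → ≈.refl) ]
          refl₂ : ∀ {x} k → snd ([ const (diagonal x) , c ] k) ≈ [ const x , snd ∘ c ] k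
          refl₂ = [ (λ _ → ≈.refl) , (λ _ → ≈.refl) ]

-- The modular commutator.

-- Gumm's shifting lemma. The path `r`, `p`, `q`, `s` puts `(r , s)` in `((π ∩ γ) ∨ ψ) ∩ π`, which
-- modularity turns into `(π ∩ γ) ∨ (ψ ∩ π)`; both joinands lie in `γ`.
shifting : (X : Algebra S ℓ) → Modular (BoundedLattice.lattice (ConLattice X)) →
  (π ψ γ : Con X) → π ∩ ψ ⊆ γ → ∀ {p q r s} →
  rel π p q → rel γ p q → rel π r s → rel ψ p r → rel ψ q s → rel γ r s
shifting X modular π ψ γ π∩ψ⊆γ {p} {q} {r} {s} πpq γpq πrs ψpr ψqs =
  ∨-least {α = π ∩ γ} {ψ ∩ π} γ proj₂ (π∩ψ⊆γ ∘ swap)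
    (proj₂ (modular (π ∩ γ) ψ π proj₁)
      (transi (base (inj₂ (Con.sym ψ ψpr))) (transi (base (inj₁ (πpq , γpq))) (base (inj₂ ψqs))) , πrs))

module CommutatorTheory {ℓ e : Level} {S : Signature} {E : Identities S e}
  (modular : CongruenceModular ℓ E) (A : Algebra S ℓ) (A∈V : A ∈Mod E) where

  open Algebra A using (_≈_)
  private module ≈ = IsEquivalence (Algebra.isEquivalence A)

  module _ (α β κ η : Con A) (α⊆ann : α ⊆ annihilator β κ) (κ⊆η : κ ⊆ η) where
    private
      P = pairs β
      Θ = saturating β κ

      shift : (π ψ γ : Con P) → π ∩ ψ ⊆ γ → ∀ {p q r s} →
        rel π p q → rel γ p q → rel π r s → rel ψ p r → rel ψ q s → rel γ r s
      shift = shifting P (modular P (pairs-∈Mod β {E = E} A∈V))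

      -- Shifting along equal second coordinates replaces the common first coordinate by `v`. Then
      -- `(v , v)` and `(v , v′)` are `Θ`-related, and saturation takes `κ` from one to the other.
      Θ-fst⇒snd : ∀ {p q} → rel Θ p q → fst β p ≈ fst β q → rel κ (snd β p) (snd β q)
      Θ-fst⇒snd {p@(u , v , uv)} {q@(u′ , v′ , uv′)} pΘq u≈u′ =
        saturating-saturates β κ {diagonal β v} {v , v′ , vv′}
          (shift (lift₁ β Δ) (lift₂ β Δ) Θ (λ {x} {y} → Con.reflexive-≈ Θ {x} {y})
            {p} {q} {diagonal β v} {v , v′ , vv′} u≈u′ pΘq ≈.refl ≈.refl ≈.refl)
          (Con.refl κ)
        where
        vv′ : rel β v v′
        vv′ = Con.trans β (Con.sym β uv) (Con.trans β (Con.reflexive-≈ β u≈u′) uv′)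

      -- Shifting in the parallelogram of `p`, `q` and the diagonal pairs over their first
      -- coordinates: `α⊆ann` makes the diagonal side a `Θ`-edge.
      rows : ∀ {p q} → rel Θ p q → rel α (fst β p) (fst β q) →
             rel η (fst β p) (snd β p) → rel η (fst β q) (snd β q)
      rows {p} {q} pΘq pαq ηp = Con.sym η
        (shift (lift₁ β Δ) Θ (lift₂ β η) (λ {x} {y} (d , xΘy) → κ⊆η (Θ-fst⇒snd {x} {y} xΘy d))
          {p} {diagonal β (fst β p)} {q} {diagonal β (fst β q)}
          ≈.refl (Con.sym η ηp) ≈.refl pΘq (α⊆ann pαq))

      -- The same parallelogram with the roles of `Θ` and equality of first coordinates exchanged.
      columns : ∀ {p q} → rel Θ p q → rel α (fst β p) (fst β q) →
                rel η (fst β p) (fst β q) → rel η (snd β p) (snd β q)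
      columns {p} {q} pΘq pαq ηpq =
        shift Θ (lift₁ β Δ) (lift₂ β η) (λ {x} {y} (xΘy , d) → κ⊆η (Θ-fst⇒snd {x} {y} xΘy d))
          {diagonal β (fst β p)} {diagonal β (fst β q)} {p} {q}
          (α⊆ann pαq) ηpq pΘq ≈.refl ≈.refl

    -- Each row of the matrix is an element of `P`; the two are `Θ`-related since `diagonal (a i)`
    -- and `diagonal (a′ i)` are.
    ⊆annihilator⇒centralizesˡ : Centralizes α β η
    ⊆annihilator⇒centralizesˡ t a a′ b b′ aαa′ bβb′ d =
      ≈-resp β η (fst-⟦⟧ β t (≈₁ a′)) (snd-⟦⟧ β t (≈₂ a′))
        (rows {⟦ t ⟧ P (row a)} {⟦ t ⟧ P (row a′)}
          (⟦⟧-compatible Θ t {row a} {row a′} [ (λ i → α⊆ann (aαa′ i)) , (λ j → Con.refl Θ {c j}) ])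
          (≈-resp β α (≈.sym (fst-⟦⟧ β t (≈₁ a))) (≈.sym (fst-⟦⟧ β t (≈₁ a′)))
            (⟦⟧-compatible α t [ aαa′ , (λ _ → Con.refl α) ]))
          (≈-resp β η (≈.sym (fst-⟦⟧ β t (≈₁ a))) (≈.sym (snd-⟦⟧ β t (≈₂ a))) d))
      where
      c : _ → Carrier P
      c j = b j , b′ j , bβb′ j
      row : (_ → Carrier A) → _ → Carrier P
      row a = [ diagonal β ∘ a , c ]
      ≈₁ : ∀ a k → fst β (row a k) ≈ [ a , b ] k
      ≈₁ a = [ (λ _ → ≈.refl) , (λ _ → ≈.refl) ]
      ≈₂ : ∀ a k → snd β (row a k) ≈ [ a , b′ ] k
      ≈₂ a = [ (λ _ → ≈.refl) , (λ _ → ≈.refl) ]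

    -- Now the elements of `P` are the columns of the matrix, so `columns` takes over; this is the
    -- source of symmetry.
    ⊆annihilator⇒centralizesʳ : Centralizes β α η
    ⊆annihilator⇒centralizesʳ t b b′ a a′ bβb′ aαa′ d =
      ≈-resp β η (snd-⟦⟧ β t (≈₂ a)) (snd-⟦⟧ β t (≈₂ a′))
        (columns {⟦ t ⟧ P (row a)} {⟦ t ⟧ P (row a′)}
          (⟦⟧-compatible Θ t {row a} {row a′} [ (λ j → Con.refl Θ {c j}) , (λ i → α⊆ann (aαa′ i)) ])
          (≈-resp β α (≈.sym (fst-⟦⟧ β t (≈₁ a))) (≈.sym (fst-⟦⟧ β t (≈₁ a′)))
            (⟦⟧-compatible α t [ (λ _ → Con.refl α) , aαa′ ]))
          (≈-resp β η (≈.sym (fst-⟦⟧ β t (≈₁ a))) (≈.sym (fst-⟦⟧ β t (≈₁ a′))) d))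
      where
      c : _ → Carrier P
      c j = b j , b′ j , bβb′ j
      row : (_ → Carrier A) → _ → Carrier P
      row a = [ c , diagonal β ∘ a ]
      ≈₁ : ∀ a k → fst β (row a k) ≈ [ b , a ] k
      ≈₁ a = [ (λ _ → ≈.refl) , (λ _ → ≈.refl) ]
      ≈₂ : ∀ a k → snd β (row a k) ≈ [ b′ , a ] k
      ≈₂ a = [ (λ _ → ≈.refl) , (λ _ → ≈.refl) ]

  -- Centrality modulo `κ = [ α , β ]ᶜ` is carried up to every larger `η`; this is where keeping `κ`
  -- apart from `η` pays.
  [,]⊆⇒centralizes : ∀ (α β η : Con A) → [ α , β ]ᶜ ⊆ η → Centralizes α β η
  [,]⊆⇒centralizes α β η = ⊆annihilator⇒centralizesˡ α β [ α , β ]ᶜ η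
    (λ {x} {y} → ⊆annihilator β [ α , β ]ᶜ α ([,]-centralizes α β) {x} {y})

  centralizes-sym : ∀ (α β η : Con A) → Centralizes α β η → Centralizes β α η
  centralizes-sym α β η C =
    ⊆annihilator⇒centralizesʳ α β η η (λ {x} {y} → ⊆annihilator β η α C {x} {y}) id

  -- The annihilator is a congruence, hence closed under joins, and every `η` centralizes `β` modulo
  -- `η` itself.
  ∨⊆annihilator : ∀ (α β η : Con A) → Centralizes α β η → α ∨ η ⊆ annihilator β η
  ∨⊆annihilator α β η C {x} {y} = ∨-least {α = α} {η} (annihilator β η)
    (λ {x} {y} → ⊆annihilator β η α C {x} {y})
    (λ {x} {y} → ⊆annihilator β η η trivially {x} {y}) {x} {y}
    where
    trivially : Centralizes η β η
    trivially t a a′ b b′ p q d =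
      Con.trans η (Con.sym η (⟦⟧-compatible η t [ p , (λ _ → Con.refl η) ]))
        (Con.trans η d (⟦⟧-compatible η t [ p , (λ _ → Con.refl η) ]))

  centralizes-∨ˡ : ∀ (α β η : Con A) → Centralizes α β η → Centralizes (α ∨ η) β η
  centralizes-∨ˡ α β η C =
    ⊆annihilator⇒centralizesˡ (α ∨ η) β η η (λ {x} {y} → ∨⊆annihilator α β η C {x} {y}) id

  -- One side is enlarged at a time, with symmetry in between. The enlarged congruences contain `η`,
  -- so they pass to quotients by congruences below `η`.
  centralizes-∨ : ∀ (α β η : Con A) → Centralizes α β η → Centralizes (α ∨ η) (β ∨ η) η
  centralizes-∨ α β η C = centralizes-sym (β ∨ η) (α ∨ η) η
    (centralizes-∨ˡ β (α ∨ η) η (centralizes-sym (α ∨ η) β η (centralizes-∨ˡ α β η C)))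

  module _ (em : ExcludedMiddle (lsuc ℓ)) (semidegenerate : Semidegenerate ℓ E) where

    -- All of the diagonal of β is one class of the congruence saturating β η,
    -- hence a one-element subalgebra of the quotient of β.
    ∇⊆annihilator⇒⊆ : ∀ (β η : Con A) → ∇ ⊆ annihilator β η → β ⊆ η
    ∇⊆annihilator⇒⊆ β η ∇⊆ann {x} {y} xβy with em {Lift (lsuc ℓ) (Trivial (pairs β / saturating β η))}
    ... | yes (lift trivial) =
      saturating-saturates β η {diagonal β x} {x , y , xβy} (trivial (diagonal β x) (x , y , xβy)) (Con.refl η)
    ... | no nontrivial =
      ⊥-elim (semidegenerate (P / Θ) (/-∈Mod {A = P} {E = E} Θ (pairs-∈Mod β {E = E} A∈V))
        (λ trivial → nontrivial (lift trivial)) one)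
      where
      P = pairs β
      Θ = saturating β η
      d = diagonal β x

      one : HasOneElementSubalgebra (P / Θ)
      one = (λ p → rel Θ p d)
          , record
            { respects = λ {p} {q} pΘq pΘd → Con.trans Θ {q} {p} {d} (Con.sym Θ {p} {q} pΘq) pΘd
            ; closed   = λ f u ps →
                Con.trans Θ {Algebra.op P f u} {Algebra.op P f (const d)} {d}
                  (Con.compatible Θ f {u} {const d} ps)
                  (Con.trans Θ {Algebra.op P f (const d)} {diagonal β (Algebra.op A f (const x))} {d}
                    (Con.reflexive-≈ Θ {Algebra.op P f (const d)} {diagonal β (Algebra.op A f (const x))}
                      (≈.refl , ≈.refl))
                    (∇⊆ann (lift tt)))
            }
          , d , Con.refl Θ {d} , λ _ pΘd → pΘd

    -- β = [∇ , β] = [α , β] ∨ [η , β] ⊆ η.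
    absorption : ∀ (α β η : Con A) → [ α , β ]ᶜ ⊆ η → ∇ ⊆ α ∨ η → β ⊆ η
    absorption α β η [α,β]⊆η ∇⊆α∨η = ∇⊆annihilator⇒⊆ β η
      (λ {x} {y} p → ∨⊆annihilator α β η ([,]⊆⇒centralizes α β η [α,β]⊆η) {x} {y} (∇⊆α∨η p))

-- Maximal congruences.

module _ (em : ExcludedMiddle (lsuc ℓ)) where

  decide : (P : Set ℓ) → Dec P
  decide P = map′ lower lift (em {Lift (lsuc ℓ) P})

  -- Zermelo's proof of Zorn's lemma.  The successor of φ is chosen from its
  -- characteristic function, since by function extensionality equivalent
  -- congruences have the same one, hence equivalent successors.
  module Zorn (extensionality : Extensionality (lsuc ℓ) (lsuc ℓ))
    {S : Signature} (B : Algebra S ℓ) (∇-compact : IsCompact (∇ {A = B})) (nontrivial : ¬ (∇ {A = B} ⊆ Δ)) where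

    code : Con B → Carrier B → Carrier B → Bool
    code φ x y = does (decide (rel φ x y))

    code-cong : ∀ (φ ψ : Con B) → φ ⊆ ψ → ψ ⊆ φ → code φ ≡ code ψ
    code-cong φ ψ φ⊆ψ ψ⊆φ =
      lower-extensionality (lsuc ℓ) (lsuc ℓ) extensionality λ x →
      lower-extensionality (lsuc ℓ) (lsuc ℓ) extensionality λ y →
      does-⇔ (mk⇔ φ⊆ψ ψ⊆φ) (decide (rel φ x y)) (decide (rel ψ x y))

    code-sound : ∀ (φ : Con B) {x y} → T (code φ x y) → rel φ x y
    code-sound φ {x} {y} = sound (decide (rel φ x y))
      where
      sound : ∀ {P : Set ℓ} (d : Dec P) → T (does d) → P
      sound (yes p) _ = p

    code-complete : ∀ (φ : Con B) {x y} → rel φ x y → T (code φ x y)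
    code-complete φ {x} {y} = complete (decide (rel φ x y))
      where
      complete : ∀ {P : Set ℓ} (d : Dec P) → P → T (does d)
      complete (yes _) _ = tt
      complete (no ¬p) p = ¬p p

    Extension : (Carrier B → Carrier B → Bool) → Set (lsuc ℓ)
    Extension k = Σ[ ψ ∈ Con B ] (∀ {x y} → T (k x y) → rel ψ x y) × ¬ (∇ ⊆ ψ)
                  × (∃[ x ] ∃[ y ] (rel ψ x y × ¬ T (k x y)))

    grow : ∀ {k} → Dec (Extension k) → Con B → Con B
    grow (yes (ψ , _)) φ = ψ
    grow (no _)        φ = φ

    next : Con B → Con B
    next φ = grow (em {Extension (code φ)}) φ

    next-cong : ∀ φ ψ → φ ⊆ ψ → ψ ⊆ φ → next φ ⊆ next ψ
    next-cong φ ψ φ⊆ψ ψ⊆φ {x} {y} p =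
      subst (λ k → rel (grow (em {Extension k}) ψ) x y) (code-cong φ ψ φ⊆ψ ψ⊆φ) (grow-mono (em {Extension (code φ)}) {x} {y} p)
      where
      grow-mono : ∀ {k} (d : Dec (Extension k)) → grow d φ ⊆ grow d ψ
      grow-mono (yes _) q = q
      grow-mono (no _)  q = φ⊆ψ q

    ⊆next : ∀ φ → φ ⊆ next φ
    ⊆next φ = ⊆grow em
      where
      ⊆grow : (d : Dec (Extension (code φ))) → φ ⊆ grow d φ
      ⊆grow (yes (_ , k⊆ψ , _)) p = k⊆ψ (code-complete φ p)
      ⊆grow (no _)              p = p

    next-proper : ∀ φ → ¬ (∇ ⊆ φ) → ¬ (∇ ⊆ next φ)
    next-proper φ φ-proper = grow-proper em
      where
      grow-proper : (d : Dec (Extension (code φ))) → ¬ (∇ ⊆ grow d φ)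
      grow-proper (yes (_ , _ , ψ-proper , _)) = ψ-proper
      grow-proper (no _)                       = φ-proper

    next-strict : ∀ φ → Extension (code φ) → ¬ (next φ ⊆ φ)
    next-strict φ extension = grow-strict em
      where
      grow-strict : (d : Dec (Extension (code φ))) → ¬ (grow d φ ⊆ φ)
      grow-strict (yes (_ , _ , _ , _ , _ , p , ¬q)) ψ⊆φ = ¬q (code-complete φ (ψ⊆φ p))
      grow-strict (no ¬extension)                    _   = ¬extension extension

    -- The empty supremum is the starting point of the tower.
    data Tower : Con B → Set (lsuc ℓ) where
      successor : ∀ {φ} → Tower φ → Tower (next φ)
      supremum  : ∀ {I : Set ℓ} (γ : I → Con B) → (∀ i → Tower (γ i)) → Tower (⋁ γ)

    -- The extreme points of the Bourbaki-Witt argument: no tower member strictly below `c` has a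
    -- successor that leaves `c`.
    Extreme : Con B → Set (lsuc ℓ)
    Extreme c = ∀ {x} → Tower x → x ⊆ c → c ⊆ x ⊎ next x ⊆ c

    extreme-compare : ∀ {c x} → Extreme c → Tower x → x ⊆ c ⊎ next c ⊆ x
    extreme-compare {c} ex (successor {x} τ) with extreme-compare {c} ex τ
    ... | inj₂ nc⊆x = inj₂ (λ p → ⊆next x (nc⊆x p))
    ... | inj₁ x⊆c with ex τ x⊆c
    ...   | inj₁ c⊆x  = inj₂ (next-cong c x c⊆x x⊆c)
    ...   | inj₂ nx⊆c = inj₁ nx⊆c
    extreme-compare {c} ex (supremum {I} γ τ) with decide (∃[ i ] next c ⊆ γ i)
    ... | yes (i , nc⊆γi) = inj₂ (λ p → base (i , nc⊆γi p))
    ... | no none = inj₁ (Cg-least c λ (i , p) → below i p)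
      where
      below : ∀ i → γ i ⊆ c
      below i with extreme-compare {c} ex (τ i)
      ... | inj₁ γi⊆c = γi⊆c
      ... | inj₂ nc⊆γi = ⊥-elim (none (i , nc⊆γi))

    extreme : ∀ {c} → Tower c → Extreme c
    extreme (successor {c} τ) {x} σ x⊆nc with extreme-compare {c} (extreme τ) σ
    ... | inj₂ nc⊆x = inj₁ nc⊆x
    ... | inj₁ x⊆c with extreme τ σ x⊆c
    ...   | inj₁ c⊆x  = inj₂ (next-cong x c x⊆c c⊆x)
    ...   | inj₂ nx⊆c = inj₂ (λ p → ⊆next c (nx⊆c p))
    extreme (supremum γ τ) {x} σ x⊆⋁ with decide (∃[ i ] x ⊆ γ i)
    ... | no none = inj₁ (Cg-least x λ (i , p) → above i p)
      where
      above : ∀ i → γ i ⊆ x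
      above i with extreme-compare {γ i} (extreme (τ i)) σ
      ... | inj₁ x⊆γi = ⊥-elim (none (i , x⊆γi))
      ... | inj₂ n⊆x  = λ p → n⊆x (⊆next (γ i) p)
    ... | yes (i , x⊆γi) with extreme (τ i) σ x⊆γi
    ...   | inj₂ nx⊆γi = inj₂ (λ p → base (i , nx⊆γi p))
    -- Here `x` and `γ i` coincide; the supremum is either no larger than `γ i` or already contains
    -- its successor.
    ...   | inj₁ γi⊆x with extreme-compare {γ i} (extreme (τ i)) (supremum γ τ)
    ...     | inj₁ ⋁⊆γi = inj₁ (λ p → γi⊆x (⋁⊆γi p))
    ...     | inj₂ n⊆⋁  = inj₂ (λ p → n⊆⋁ (next-cong x (γ i) x⊆γi γi⊆x p))

    tower-total : ∀ {x y} → Tower x → Tower y → x ⊆ y ⊎ y ⊆ x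
    tower-total {x} {y} σ τ with extreme-compare {y} (extreme τ) σ
    ... | inj₁ x⊆y = inj₁ x⊆y
    ... | inj₂ n⊆x = inj₂ (λ p → n⊆x (⊆next y p))

    -- If a supremum were `∇`, compactness would give finitely many members with join `∇`; the tower
    -- is a chain, so a single proper member bounds them.
    tower-proper : ∀ {φ} → Tower φ → ¬ (∇ ⊆ φ)
    tower-proper (successor {φ} τ) = next-proper φ (tower-proper τ)
    tower-proper (supremum {I} γ τ) ∇⊆⋁ =
      let js , ∇⊆⋁js = ∇-compact γ ∇⊆⋁
          δ , _ , δ-proper , γ⊆δ = bound js
      in δ-proper (λ p → Cg-least {R = λ x y → ∃[ i ] rel (restrict γ js i) x y} δ
                           (λ ((i , i∈js) , q) → γ⊆δ i∈js q) (∇⊆⋁js p))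
      where
      bound : (js : List I) → Σ[ δ ∈ Con B ] Tower δ × ¬ (∇ ⊆ δ) × (∀ {i} → i ∈ js → γ i ⊆ δ)
      -- The empty list is bounded by the empty join, proper because `B` is nontrivial.
      bound [] = ⋁ none , supremum none (λ ())
               , (λ ∇⊆⊥ → nontrivial (λ p → Cg-least {R = λ x y → ∃[ i ] rel (none i) x y} Δ (λ ()) (∇⊆⊥ p)))
               , λ ()
        where
        none : Lift ℓ ⊥ → Con B
        none ()
      bound (j ∷ js) with bound js
      ... | δ , σ , δ-proper , γ⊆δ with tower-total (τ j) σ
      ...   | inj₁ γj⊆δ = δ , σ , δ-proper , λ { (here refl) → γj⊆δ ; (there i∈) → γ⊆δ i∈ }
      ...   | inj₂ δ⊆γj = γ j , τ j , tower-proper (τ j)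
                        , λ { (here refl) p → p ; (there i∈) p → δ⊆γj (γ⊆δ i∈ p) }

    private
      Reached : Carrier B → Carrier B → Set (lsuc ℓ)
      Reached x y = Σ[ φ ∈ Con B ] Tower φ × rel φ x y

      -- `⋁` wants an index type in `Set ℓ`, while `Tower` lives one level up; the index records a
      -- pair and a decided proof that some member contains it.
      Index : Set ℓ
      Index = ∃[ x ] ∃[ y ] True (em {Reached x y})

      member : Index → Con B
      member (_ , _ , w) = proj₁ (toWitness w)

    maximum : Con B
    maximum = ⋁ member

    maximum-tower : Tower maximum
    maximum-tower = supremum member (λ (_ , _ , w) → proj₁ (proj₂ (toWitness w)))

    maximum-proper : ¬ (∇ ⊆ maximum)
    maximum-proper = tower-proper maximum-tower

    -- A proper `ψ` strictly above would make `next maximum` strictly larger, yet that is a tower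
    -- member and so lies below `maximum`.
    maximum-maximal : ∀ ψ → maximum ⊆ ψ → ¬ (∇ ⊆ ψ) → ψ ⊆ maximum
    maximum-maximal ψ m⊆ψ ψ-proper {x} {y} p with decide (rel maximum x y)
    ... | yes q = q
    ... | no ¬q = ⊥-elim (next-strict maximum
            (ψ , (λ k → m⊆ψ (code-sound maximum k)) , ψ-proper , x , y , p , (λ k → ¬q (code-sound maximum k)))
            λ r → let w = fromWitness (next maximum , successor maximum-tower , r)
                  in base ((_ , _ , w) , proj₂ (proj₂ (toWitness w))))

-- Pullbacks from quotients and compact covers.

module _ {A : Algebra S ℓ} where

  pullback : (θ : Con A) → Con (A / θ) → Con A
  pullback θ χ = record
    { rel           = rel χ
    ; isEquivalence = Con.isEquivalence χ
    ; reflexive-≈   = λ p → Con.reflexive-≈ χ (Con.reflexive-≈ θ p)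
    ; compatible    = Con.compatible χ
    }

  -- A join in `A / θ` may also use `θ`-steps as equalities, but these already lie in
  -- `pullback θ β`.
  ∨-pullback : (θ : Con A) (β γ : Con (A / θ)) → pullback θ (β ∨ γ) ⊆ pullback θ β ∨ pullback θ γ
  ∨-pullback θ β γ = Cg-least
    (quotient (pullback θ β ∨ pullback θ γ) θ (λ p → base (inj₁ (Con.reflexive-≈ β p)))) base

  principal : Carrier A → Carrier A → Con A
  principal x y = Cg (λ u v → u ≡ x × v ≡ y)

  principal-compact : ∀ x y → IsCompact (principal x y)
  principal-compact x y γ p =
    let js , q = ⋁-finitary γ (p (base (refl , refl)))
    in js , Cg-least (⋁ (restrict γ js)) λ { (refl , refl) → q }

  -- The principal congruences of pairs from `β` or `γ` cover `∇`; a finite subcover is sorted by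
  -- the side each pair comes from.
  compact-cover : IsCompact (∇ {A = A}) → (β γ : Con A) → ∇ ⊆ β ∨ γ →
    Σ[ β₀ ∈ Con A ] Σ[ γ₀ ∈ Con A ] IsCompact β₀ × IsCompact γ₀ × β₀ ⊆ β × γ₀ ⊆ γ × ∇ ⊆ β₀ ∨ γ₀
  compact-cover ∇-compact β γ ∇⊆β∨γ =
    let js , ∇⊆⋁js = ∇-compact generator
          (λ p → Cg-least (⋁ generator) (λ q → base ((_ , _ , q) , base (refl , refl))) (∇⊆β∨γ p))
        β₀ , γ₀ , cβ , cγ , β₀⊆β , γ₀⊆γ , js⊆ = split js
    in β₀ , γ₀ , (λ {I} → cβ {I}) , (λ {I} → cγ {I}) , β₀⊆β , γ₀⊆γ
     , λ p → Cg-least (β₀ ∨ γ₀)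
         (λ ((i , i∈js) , q) → Cg-least (β₀ ∨ γ₀) (λ { (refl , refl) → js⊆ i∈js }) q) (∇⊆⋁js p)
    where
    Generator : Set _
    Generator = ∃[ x ] ∃[ y ] (rel β x y ⊎ rel γ x y)

    generator : Generator → Con A
    generator (x , y , _) = principal x y

    split : (js : List Generator) → Σ[ β₀ ∈ Con A ] Σ[ γ₀ ∈ Con A ] IsCompact β₀ × IsCompact γ₀ ×
      β₀ ⊆ β × γ₀ ⊆ γ × (∀ {i} → i ∈ js → rel (β₀ ∨ γ₀) (proj₁ i) (proj₁ (proj₂ i)))
    split [] = Δ , Δ , (λ {I} → Δ-compact {I = I}) , (λ {I} → Δ-compact {I = I})
             , Con.reflexive-≈ β , Con.reflexive-≈ γ , λ ()
    split ((x , y , inj₁ p) ∷ js) =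
      let β₀ , γ₀ , cβ , cγ , β₀⊆β , γ₀⊆γ , js⊆ = split js
          β₁ = principal x y ∨ β₀
      in β₁ , γ₀
       , (λ {I} → ∨-compact {α = principal x y} {β₀} (principal-compact x y) cβ {I}) , (λ {I} → cγ {I})
       , ∨-least {α = principal x y} {β₀} β (Cg-least β (λ { (refl , refl) → p })) β₀⊆β , γ₀⊆γ
       , λ { (here refl) → base (inj₁ (base (inj₁ (base (refl , refl)))))
           ; (there i∈)  → ∨-least {α = β₀} {γ₀} (β₁ ∨ γ₀)
               (λ q → base (inj₁ (base (inj₂ q)))) (λ q → base (inj₂ q)) (js⊆ i∈) }
    split ((x , y , inj₂ p) ∷ js) =
      let β₀ , γ₀ , cβ , cγ , β₀⊆β , γ₀⊆γ , js⊆ = split js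
          γ₁ = principal x y ∨ γ₀
      in β₀ , γ₁
       , (λ {I} → cβ {I}) , (λ {I} → ∨-compact {α = principal x y} {γ₀} (principal-compact x y) cγ {I})
       , β₀⊆β , ∨-least {α = principal x y} {γ₀} γ (Cg-least γ (λ { (refl , refl) → p })) γ₀⊆γ
       , λ { (here refl) → base (inj₂ (base (inj₁ (base (refl , refl)))))
           ; (there i∈)  → ∨-least {α = β₀} {γ₀} (β₀ ∨ γ₁)
               (λ q → base (inj₁ q)) (λ q → base (inj₂ (base (inj₂ q)))) (js⊆ i∈) }

-- Prime congruences and the lifting of complemented ones.

module Lifting {ℓ e : Level} (em : ExcludedMiddle (lsuc ℓ))
  (extensionality : Extensionality (lsuc ℓ) (lsuc ℓ)) {S : Signature} {E : Identities S e}
  (modular : CongruenceModular ℓ E) (semidegenerate : Semidegenerate ℓ E)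
  (A : Algebra S ℓ) (A∈V : A ∈Mod E) where

  open CommutatorTheory {E = E} modular A A∈V

  absorb : ∀ (α β η : Con A) → [ α , β ]ᶜ ⊆ η → ∇ ⊆ α ∨ η → β ⊆ η
  absorb = absorption em semidegenerate

  prime-⊇∩ : ∀ {φ} → IsPrime φ → (α β : Con A) → α ∩ β ⊆ φ → α ⊆ φ ⊎ β ⊆ φ
  prime-⊇∩ P α β ∩⊆φ = IsPrime.prime P α β (λ p → ∩⊆φ ([,]⊆ˡ α β p , [,]⊆ʳ α β p))

  prime-proper : ∀ {φ : Con A} → IsPrime φ → ¬ (∇ ⊆ φ)
  prime-proper P ∇⊆φ = IsPrime.proper P ((λ _ → lift tt) , ∇⊆φ)

  -- A proper `χ` lies in a maximal congruence `M`, found in `A / χ`. It is prime: either `α ∨ M` is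
  -- `∇` and absorption gives `β ⊆ M`, or maximality gives `α ⊆ M`.
  unless-in-prime : (χ : Con A) → (∀ φ → IsPrime φ → ¬ (χ ⊆ φ)) → ∇ ⊆ χ
  unless-in-prime χ none with decide em (∇ ⊆ χ)
  ... | yes ∇⊆χ = ∇⊆χ
  ... | no χ-proper = ⊥-elim (none M record { proper = λ (_ , ∇⊆M) → maximum-proper ∇⊆M ; prime = prime }
                                (Con.reflexive-≈ maximum))
    where
    open Zorn em extensionality (A / χ)
      (semidegenerate⇒∇-compact {E = E} em semidegenerate (A / χ) (/-∈Mod {A = A} {E = E} χ A∈V)) χ-proper

    M : Con A
    M = pullback χ maximum

    prime : ∀ α β → [ α , β ]ᶜ ⊆ M → α ⊆ M ⊎ β ⊆ M
    prime α β [α,β]⊆M with decide em (∇ ⊆ α ∨ M)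
    ... | yes ∇⊆α∨M = inj₂ (absorb α β M [α,β]⊆M ∇⊆α∨M)
    ... | no α∨M-proper = inj₁ (λ p → maximum-maximal
            (quotient (α ∨ M) χ (λ q → base (inj₂ (Con.reflexive-≈ maximum q))))
            (λ q → base (inj₂ q)) α∨M-proper (base (inj₁ p)))

  module _ (θ : Con A) where

    -- `α` and `β` need not contain `θ`, so both are first joined with `φ`, which preserves
    -- centrality modulo `φ`.
    pullback-prime : (φ : Con (A / θ)) → IsPrime φ → IsPrime (pullback θ φ)
    pullback-prime φ P = record
      { proper = λ (_ , ∇⊆φ) → IsPrime.proper P ((λ _ → lift tt) , ∇⊆φ)
      ; prime  = λ α β [α,β]⊆φ → restrict-⊎ α β
          (IsPrime.prime P (∨φ α) (∨φ β) ([,]-least (∨φ α) (∨φ β) φ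
            (centralizes-∨ α β (pullback θ φ) ([,]⊆⇒centralizes α β (pullback θ φ) [α,β]⊆φ))))
      }
      where
      ∨φ : Con A → Con (A / θ)
      ∨φ α = quotient (α ∨ pullback θ φ) θ (λ p → base (inj₂ (Con.reflexive-≈ φ p)))

      restrict-⊎ : ∀ α β → ∨φ α ⊆ φ ⊎ ∨φ β ⊆ φ → α ⊆ pullback θ φ ⊎ β ⊆ pullback θ φ
      restrict-⊎ α β (inj₁ α∨φ⊆φ) = inj₁ (λ p → α∨φ⊆φ (base (inj₁ p)))
      restrict-⊎ α β (inj₂ β∨φ⊆φ) = inj₂ (λ p → β∨φ⊆φ (base (inj₁ p)))

    quotient-prime : (φ : Con A) (θ⊆φ : θ ⊆ φ) → IsPrime φ → IsPrime (quotient φ θ θ⊆φ)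
    quotient-prime φ θ⊆φ P = record
      { proper = λ (_ , ∇⊆φ) → IsPrime.proper P ((λ _ → lift tt) , ∇⊆φ)
      ; prime  = λ α β [α,β]⊆φ →
          IsPrime.prime P (pullback θ α) (pullback θ β)
            (λ p → [α,β]⊆φ ([,]-least (pullback θ α) (pullback θ β) (pullback θ [ α , β ]ᶜ) ([,]-centralizes α β) p))
      }

    private
      R : Con A
      R = ρ em θ

      θ⊆R : θ ⊆ R
      θ⊆R p = ρ-intro em θ (λ φ _ θ⊆φ → θ⊆φ p)

      R⊆ : ∀ {φ} → IsPrime φ → θ ⊆ φ → R ⊆ φ
      R⊆ {φ} P θ⊆φ p = ρ-elim em θ p φ P θ⊆φ

    -- A prime above `θ` contains `R`, so one containing `α′ ∨ β` would contain `α` too and be `∇`;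
    -- hence `α′ ∨ β` is `∇` and absorption applies. The second half runs alike, with `γ` as
    -- complement.
    ρ-lift : (α α′ β γ : Con A) → ∇ ⊆ α ∨ α′ → α ∩ α′ ⊆ Δ → θ ⊆ β → ∇ ⊆ β ∨ γ → β ∩ γ ⊆ θ →
             α ⊆ β ∨ R → β ⊆ α ∨ R → α ⊆ β × β ⊆ α ∨ θ
    ρ-lift α α′ β γ ∇⊆α∨α′ α∩α′⊆Δ θ⊆β ∇⊆β∨γ β∩γ⊆θ α⊆β∨R β⊆α∨R =
      absorb α′ α β
        (λ p → Con.reflexive-≈ β (α∩α′⊆Δ ([,]⊆ʳ α′ α p , [,]⊆ˡ α′ α p)))
        (unless-in-prime (α′ ∨ β) λ φ P χ⊆φ →
          prime-proper P (λ p → ∨-least {α = α} {α′} φ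
            (λ q → ∨-least {α = β} {R} φ (λ r → χ⊆φ (base (inj₂ r)))
                     (R⊆ P (λ r → χ⊆φ (base (inj₂ (θ⊆β r))))) (α⊆β∨R q))
            (λ q → χ⊆φ (base (inj₁ q)))
            (∇⊆α∨α′ p))) ,
      absorb γ β (α ∨ θ)
        (λ p → base (inj₂ (β∩γ⊆θ ([,]⊆ʳ γ β p , [,]⊆ˡ γ β p))))
        (unless-in-prime (γ ∨ (α ∨ θ)) λ φ P χ⊆φ →
          prime-proper P (λ p → ∨-least {α = β} {γ} φ
            (λ q → ∨-least {α = α} {R} φ (λ r → χ⊆φ (base (inj₂ (base (inj₁ r)))))
                     (R⊆ P (λ r → χ⊆φ (base (inj₂ (base (inj₂ r)))))) (β⊆α∨R q))
            (λ q → χ⊆φ (base (inj₁ q)))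
            (∇⊆β∨γ p)))

    -- Each prime above `θ` contains `β` or `γ`, hence one of the two joins with `R`; so these joins
    -- meet in `R`.
    ∨ρ-complemented : (β γ : Con A) → ∇ ⊆ β ∨ γ → β ∩ γ ⊆ θ →
      Complemented (ConLattice (A / R)) (quotient (β ∨ R) R (λ p → base (inj₂ p)))
    ∨ρ-complemented β γ ∇⊆β∨γ β∩γ⊆θ = γR
      , ((λ _ → lift tt)
        , λ p → ∨-least {α = β} {γ} (pullback R (βR ∨ γR))
            (λ q → base (inj₁ (base (inj₁ q)))) (λ q → base (inj₂ (base (inj₁ q)))) (∇⊆β∨γ p))
      , ((λ (p , q) → ρ-intro em θ λ φ P θ⊆φ →
            case prime-⊇∩ P β γ (λ r → θ⊆φ (β∩γ⊆θ r)) of λ where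
              (inj₁ β⊆φ) → ∨-least {α = β} {R} φ β⊆φ (R⊆ P θ⊆φ) p
              (inj₂ γ⊆φ) → ∨-least {α = γ} {R} φ γ⊆φ (R⊆ P θ⊆φ) q)
        , λ p → base (inj₂ p) , base (inj₂ p))
      where
      βR γR : Con (A / R)
      βR = quotient (β ∨ R) R (λ p → base (inj₂ p))
      γR = quotient (γ ∨ R) R (λ p → base (inj₂ p))

    -- `β` is pushed up to `A / R` and lifted there; by `ρ-lift` the lift agrees with `β` already
    -- over `θ`.
    CBLP-ρ⇒CBLP : CBLP R → CBLP θ
    CBLP-ρ⇒CBLP lifts β (γ , (_ , ∇⊆β∨γ) , β∩γ⊆Δ , _) =
      conclude (lifts (quotient (pullback θ β ∨ R) R (λ p → base (inj₂ p)))
        (∨ρ-complemented (pullback θ β) (pullback θ γ) ∇⊆ β∩γ⊆Δ))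
      where
      ∇⊆ : ∇ ⊆ pullback θ β ∨ pullback θ γ
      ∇⊆ p = ∨-pullback θ β γ (∇⊆β∨γ p)

      conclude : Σ[ α ∈ Con A ] Complemented (ConLattice A) α
                   × quotient (α ∨ R) R (λ p → base (inj₂ p)) ≐ quotient (pullback θ β ∨ R) R (λ p → base (inj₂ p)) →
                 Σ[ α ∈ Con A ] Complemented (ConLattice A) α
                   × quotient (α ∨ θ) θ (λ p → base (inj₂ p)) ≐ β
      conclude (α , c@(α′ , (_ , ∇⊆α∨α′) , α∩α′⊆Δ , _) , α∨R⊆ , ⊆α∨R) =
        α , c , ∨-least {α = α} {θ} (pullback θ β) (proj₁ α≐β) (Con.reflexive-≈ β) , proj₂ α≐β
        where
        α≐β : α ⊆ pullback θ β × pullback θ β ⊆ α ∨ θ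
        α≐β = ρ-lift α α′ (pullback θ β) (pullback θ γ) ∇⊆α∨α′ α∩α′⊆Δ (Con.reflexive-≈ β) ∇⊆ β∩γ⊆Δ
          (λ p → α∨R⊆ (base (inj₁ p))) (λ p → ⊆α∨R (base (inj₁ p)))

    module _ (β γ : Con A) (R⊆β : R ⊆ β) (∇⊆β∨γ : ∇ ⊆ β ∨ γ) (β∩γ⊆R : β ∩ γ ⊆ R)
      (β₀ γ₀ : Con (A / θ)) (β₀⊆β : pullback θ β₀ ⊆ β) (γ₀⊆γ : pullback θ γ₀ ⊆ γ) (∇⊆β₀∨γ₀ : ∇ ⊆ β₀ ∨ γ₀) where

      -- Primes of `A / θ` pull back to primes above `θ`, hence above `R` and `β ∩ γ`. So `β₀` and
      -- `γ₀` meet in the bottom of the reticulation.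
      ρ[β₀,γ₀]⊆ρΔ : ρ em [ β₀ , γ₀ ]ᶜ ⊆ ρ em Δ
      ρ[β₀,γ₀]⊆ρΔ p = ρ-intro em Δ λ φ P _ → ρ-elim em [ β₀ , γ₀ ]ᶜ p φ P λ q →
        R⊆ (pullback-prime φ P) (Con.reflexive-≈ φ)
          (β∩γ⊆R (β₀⊆β ([,]⊆ˡ β₀ γ₀ q) , γ₀⊆γ ([,]⊆ʳ β₀ γ₀ q)))

      module _ (α α′ : Con (A / θ)) (∇⊆α∨α′ : ∇ ⊆ α ∨ α′) (α∩α′⊆Δ : α ∩ α′ ⊆ Δ) (ρα≐ρβ₀ : ρ em α ≐ ρ em β₀) where
        private
          αA α′A : Con A
          αA  = pullback θ α
          α′A = pullback θ α′

        module _ {φ : Con A} (P : IsPrime φ) (θ⊆φ : θ ⊆ φ) where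

          β₀⊆⇒α⊆ : pullback θ β₀ ⊆ φ → αA ⊆ φ
          β₀⊆⇒α⊆ β₀⊆φ p =
            ρ-elim em β₀ (proj₁ ρα≐ρβ₀ (ρ-intro em α λ _ _ α⊆ψ → α⊆ψ p))
              (quotient φ θ θ⊆φ) (quotient-prime φ θ⊆φ P) β₀⊆φ

          α⊆⇒β₀⊆ : αA ⊆ φ → pullback θ β₀ ⊆ φ
          α⊆⇒β₀⊆ α⊆φ p =
            ρ-elim em α (proj₂ ρα≐ρβ₀ (ρ-intro em β₀ λ _ _ β₀⊆ψ → β₀⊆ψ p))
              (quotient φ θ θ⊆φ) (quotient-prime φ θ⊆φ P) α⊆φ

          β⊆⊎γ⊆ : β ⊆ φ ⊎ γ ⊆ φ
          β⊆⊎γ⊆ = prime-⊇∩ P β γ (λ p → R⊆ P θ⊆φ (β∩γ⊆R p))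

          [γ,α]⊆ : [ γ , αA ]ᶜ ⊆ φ
          [γ,α]⊆ p = case β⊆⊎γ⊆ of λ where
            (inj₁ β⊆φ) → β₀⊆⇒α⊆ (λ q → β⊆φ (β₀⊆β q)) ([,]⊆ʳ γ αA p)
            (inj₂ γ⊆φ) → γ⊆φ ([,]⊆ˡ γ αA p)

          [α′,β]⊆ : [ α′A , β ]ᶜ ⊆ φ
          [α′,β]⊆ p = case prime-⊇∩ P αA α′A (λ q → θ⊆φ (α∩α′⊆Δ q)) , β⊆⊎γ⊆ of λ where
            (inj₂ α′⊆φ , _)       → α′⊆φ ([,]⊆ˡ α′A β p)
            (inj₁ _ , inj₁ β⊆φ)   → β⊆φ ([,]⊆ʳ α′A β p)
            -- `α` and `β₀` lie in the same primes, so this `φ` would contain both `β₀` and `γ₀`,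
            -- whose join is `∇`.
            (inj₁ α⊆φ , inj₂ γ⊆φ) → ⊥-elim (prime-proper P λ q →
              ∨-least {α = pullback θ β₀} {pullback θ γ₀} φ (α⊆⇒β₀⊆ α⊆φ) (λ r → γ⊆φ (γ₀⊆γ r))
                (∨-pullback θ β₀ γ₀ (∇⊆β₀∨γ₀ q)))

        -- `[ γ , αA ]ᶜ` lies in every prime above `θ`, hence in `R`, and `γ ∨ β` is `∇`:
        -- absorption.
        center⊆ : αA ⊆ β
        center⊆ = absorb γ αA β
          (λ p → R⊆β (ρ-intro em θ λ φ P θ⊆φ → [γ,α]⊆ P θ⊆φ p))
          (λ p → ∨-least {α = β} {γ} (γ ∨ β) (λ q → base (inj₂ q)) (λ q → base (inj₁ q)) (∇⊆β∨γ p))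

        ⊆center∨ρ : β ⊆ αA ∨ R
        ⊆center∨ρ = absorb α′A β (αA ∨ R)
          (λ p → base (inj₂ (ρ-intro em θ λ φ P θ⊆φ → [α′,β]⊆ P θ⊆φ p)))
          (λ p → ∨-least {α = αA} {α′A} (α′A ∨ (αA ∨ R))
            (λ q → base (inj₂ (base (inj₁ q)))) (λ q → base (inj₁ q)) (∨-pullback θ α α′ (∇⊆α∨α′ p)))

    CBLP⇒CBLP-ρ : (∇-compact : IsCompact (∇ {A = A / θ})) (closed : CompactClosedUnderCommutator (A / θ)) →
                  PreservesBooleanCenter em (A / θ) ∇-compact closed → CBLP θ → CBLP R
    CBLP⇒CBLP-ρ ∇-compact closed preserves lifts β (γ , (_ , ∇⊆β∨γ) , β∩γ⊆Δ , _) =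
      from-cover (compact-cover ∇-compact βB γB
        (λ p → ∨-least {α = pullback R β} {pullback R γ} (pullback θ (βB ∨ γB))
          (λ q → base (inj₁ q)) (λ q → base (inj₂ q)) (∇⊆ p)))
      where
      βB γB : Con (A / θ)
      βB = quotient (pullback R β) θ (λ p → Con.reflexive-≈ β (θ⊆R p))
      γB = quotient (pullback R γ) θ (λ p → Con.reflexive-≈ γ (θ⊆R p))

      ∇⊆ : ∇ ⊆ pullback R β ∨ pullback R γ
      ∇⊆ p = ∨-pullback R β γ (∇⊆β∨γ p)

      Lift-of-β : Set (lsuc ℓ)
      Lift-of-β = Σ[ α ∈ Con A ] Complemented (ConLattice A) α × quotient (α ∨ R) R (λ p → base (inj₂ p)) ≐ β

      from-lift : (α : Con (A / θ)) → pullback θ α ⊆ pullback R β → pullback R β ⊆ pullback θ α ∨ R →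
        Σ[ α₀ ∈ Con A ] Complemented (ConLattice A) α₀ × quotient (α₀ ∨ θ) θ (λ p → base (inj₂ p)) ≐ α →
        Lift-of-β
      from-lift α α⊆β β⊆α∨R (α₀ , c , α₀∨θ⊆α , α⊆α₀∨θ) =
        α₀ , c
           , ∨-least {α = α₀} {R} (pullback R β) (λ p → α⊆β (α₀∨θ⊆α (base (inj₁ p)))) (Con.reflexive-≈ β)
           , λ p → ∨-least {α = pullback θ α} {R} (α₀ ∨ R)
               (λ q → ∨-least {α = α₀} {θ} (α₀ ∨ R) (λ r → base (inj₁ r)) (λ r → base (inj₂ (θ⊆R r))) (α⊆α₀∨θ q))
               (λ q → base (inj₂ q)) (β⊆α∨R p)

      from-cover : Σ[ β₀ ∈ Con (A / θ) ] Σ[ γ₀ ∈ Con (A / θ) ]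
        IsCompact β₀ × IsCompact γ₀ × β₀ ⊆ βB × γ₀ ⊆ γB × ∇ ⊆ β₀ ∨ γ₀ → Lift-of-β
      from-cover (β₀ , γ₀ , cβ , cγ , β₀⊆β , γ₀⊆γ , ∇⊆β₀∨γ₀) =
        -- `γ₀` is the complement of `β₀` in the reticulation of `A / θ`, so the preserved center
        -- supplies a complemented `α` with the same radical.
        from-center (preserves (β₀ , cβ)
          ( (γ₀ , cγ)
          , (ρ-mono em (β₀ ∨ γ₀) ∇ (λ _ → lift tt) , ρ-mono em ∇ (β₀ ∨ γ₀) ∇⊆β₀∨γ₀)
          , ρ[β₀,γ₀]⊆ρΔ (pullback R β) (pullback R γ) (Con.reflexive-≈ β) ∇⊆ β∩γ⊆Δ β₀ γ₀ β₀⊆β γ₀⊆γ ∇⊆β₀∨γ₀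
          , ρ-mono em Δ [ β₀ , γ₀ ]ᶜ (Con.reflexive-≈ [ β₀ , γ₀ ]ᶜ)))
        where
        from-center : Σ[ α ∈ Σ[ α ∈ Con (A / θ) ] IsCompact α ]
          Complemented (ConLattice (A / θ)) (proj₁ α) × ρ em (proj₁ α) ≐ ρ em β₀ → Lift-of-β
        from-center ((α , _) , c@(α′ , (_ , ∇⊆α∨α′) , α∩α′⊆Δ , _) , ρα≐ρβ₀) = from-lift α
          (center⊆ (pullback R β) (pullback R γ) (Con.reflexive-≈ β) ∇⊆ β∩γ⊆Δ β₀ γ₀ β₀⊆β γ₀⊆γ ∇⊆β₀∨γ₀
            α α′ ∇⊆α∨α′ α∩α′⊆Δ ρα≐ρβ₀)
          (⊆center∨ρ (pullback R β) (pullback R γ) (Con.reflexive-≈ β) ∇⊆ β∩γ⊆Δ β₀ γ₀ β₀⊆β γ₀⊆γ ∇⊆β₀∨γ₀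
            α α′ ∇⊆α∨α′ α∩α′⊆Δ ρα≐ρβ₀)
          (lifts α c)

theorem5p4 : {ℓ e : Level}
    (em : ExcludedMiddle (lsuc ℓ)) →
    Extensionality (lsuc ℓ) (lsuc ℓ) →
    (S : Signature) (E : Identities S e) →
    CongruenceModular ℓ E →
    (semidegenerate : Semidegenerate ℓ E) →
    (closed : (B : Algebra S ℓ) → B ∈Mod E → CompactClosedUnderCommutator B) →
    ((B : Algebra S ℓ) (B∈V : B ∈Mod E) →
    PreservesBooleanCenter em B
    (semidegenerate⇒∇-compact {E = E} em semidegenerate B B∈V) (closed B B∈V)) →
    (A : Algebra S ℓ) → A ∈Mod E →
    (θ : Con A) →
    CBLP θ ⇔ CBLP (ρ em θ)
theorem5p4 em extensionality S E modular semidegenerate closed preserves A A∈V θ =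
  mk⇔ (CBLP⇒CBLP-ρ θ (semidegenerate⇒∇-compact {E = E} em semidegenerate (A / θ) A/θ∈V)
        (closed (A / θ) A/θ∈V) (preserves (A / θ) A/θ∈V)) (CBLP-ρ⇒CBLP θ)
  where
  open Lifting em extensionality {E = E} modular semidegenerate A A∈V

  A/θ∈V : (A / θ) ∈Mod E
  A/θ∈V = /-∈Mod {A = A} {E = E} θ A∈V
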